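{- There are infinitely many rational Diophantine sextuples such that the denominators of all the elements (written in lowest terms) of the sextuple are perfect squares.
   Context: A rational Diophantine $m$-tuple is a set of $m$ nonzero rational numbers $\{a_1,\ldots,a_m\}$ such that $a_ia_j+1$ is the square of a rational number for all $1\le i<j\le m$. A rational Diophantine sextuple is a rational Diophantine $6$-tuple. -}

module Defs where

open import Data.Nat using (ℕ)
open import Data.Fin using (Fin)
open import Data.Rational using (ℚ; 0ℚ; 1ℚ; _+_; _*_; ↧ₙ_)
open import Data.Product using (∃; _×_; Σ)
open import Relation.Binary.PropositionalEquality using (_≡_; _≢_)
open import Relation.Nullary using (¬_)

IsRationalSquare : ℚ → Set
IsRationalSquare q = ∃ λ (r : ℚ) → q ≡ r * r

IsPerfectSquare : ℕ → Set
IsPerfectSquare n = ∃ λ (k : ℕ) → n ≡ k Data.Nat.* k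

record IsRationalDiophantineTuple (m : ℕ) (a : Fin m → ℚ) : Set where
  field
    distinct : ∀ i j → a i ≡ a j → i ≡ j
    nonzero  : ∀ i → a i ≢ 0ℚ
    squares  : ∀ i j → i ≢ j → IsRationalSquare (a i * a j + 1ℚ)

IsRationalDiophantineSextuple : (Fin 6 → ℚ) → Set
IsRationalDiophantineSextuple = IsRationalDiophantineTuple 6

-- all elements have (lowest terms) denominators that are perfect squares
-- (stdlib ℚ is always normalised, with positive denominator ↧ₙ)
HasSquareDenominators : ∀ {m} → (Fin m → ℚ) → Set
HasSquareDenominators a = ∀ i → IsPerfectSquare (↧ₙ (a i))

SameSet : ∀ {m} → (Fin m → ℚ) → (Fin m → ℚ) → Set
SameSet {m} a b = (∀ i → ∃ λ j → a i ≡ b j) × (∀ j → ∃ λ i → b j ≡ a i)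

{-# OPTIONS --safe #-}

-- Let T = 24/25 and X = 7/25, so that T² + X² = 1. A rational point (u, y) on
--   y² = 4u⁴ - (4 + X²)u² + 1
-- makes a = 2Tu², b = 2(u² - 1)/T, c = -T/(2u²), d = (4u² - 1)/(2Tu²) a Diophantine quadruple
-- with ab + 1 = r² and cd + 1 = (r/(r + 1))², where r = 2u² - 1. This relation between the two
-- roots is what forces ef + 1 to be a square for the two numbers
--   e, f = X²(2u² + 1)/(2T(2u² - 1)) ± 2Xuy/(T(2u² - 1)²)
-- that extend {a, b, c, d} to regular quintuples.
--
-- Doubling on this curve is u ↦ 2uy/(1 - 4u⁴). On the orbit of the chosen point u is prime to 3,
-- and then the factors 2 and 3 coming from T cancel or occur to even powers, so that all
-- denominators are squares. Each doubling raises the 2-adic valuation of u by one; since d has the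
-- largest power of 2 in its denominator, the sextuples are pairwise different.
module Submission where

open import Defs
open import Data.Nat using (ℕ)
open import Data.Fin using (Fin)
open import Data.Rational using (ℚ)
open import Data.Product using (Σ; _×_)
open import Relation.Binary.PropositionalEquality using (_≡_)
open import Relation.Nullary using (¬_)

open import Data.Empty using (⊥-elim)
open import Data.Fin using (zero; suc)
import Data.Fin.Base as Fin
import Data.Fin.Properties as Fin
open import Data.Integer.Base using (ℤ; +_; -[1+_]; -_; _+_; _-_; _*_; _^_; ∣_∣; 0ℤ; 1ℤ)
open import Data.Integer.Divisibility.Signed
  using (_∣_; ∣ᵤ⇒∣; ∣⇒∣ᵤ; ∣m∣n⇒∣m+n; ∣n⇒∣m*n)
import Data.Integer.Properties as ℤ
open import Data.Integer.Tactic.RingSolver using (solve; solve-∀)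
open import Data.List.Base using ([]; _∷_)
open import Data.Nat.Base using (zero; suc; z≤n; s≤s; ⌊_/2⌋)
import Data.Nat.Base as ℕ
open import Data.Nat.Coprimality using (Coprime)
import Data.Nat.Divisibility as ℕ
import Data.Nat.Properties as ℕ
open import Data.Product using (∃; _,_)
open import Data.Rational using (mkℚ; ↥_; ↧_; 1ℚ; toℚᵘ; fromℚᵘ)
import Data.Rational as ℚ
import Data.Rational.Properties as ℚ
open import Data.Rational.Unnormalised using (ℚᵘ; mkℚᵘ; *≡*; 1ℚᵘ)
import Data.Rational.Unnormalised as ℚᵘ
import Data.Rational.Unnormalised.Properties as ℚᵘ
open import Data.Sum using (inj₁; inj₂)
open import Relation.Nullary.Decidable using (decidable-stable)
open import Relation.Binary.Definitions using (tri<; tri≈; tri>)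
open import Relation.Binary.PropositionalEquality
  using (_≢_; refl; sym; trans; cong; cong₂; subst)

-- The ring solver uses no hypotheses: an identity modulo l ≡ r is given by its cofactor k.
adjust : ∀ {x y l r : ℤ} → l ≡ r → (k : ℤ) → x ≡ y + (l - r) * k → x ≡ y
adjust {y = y} {l = l} refl k x≡ = trans x≡ (vanish y l k)
  where
  vanish : ∀ y l k → y + (l - l) * k ≡ y
  vanish = solve-∀

-- Coprimality

infix 4 _⊥_

-- Coprimality is carried as a Bézout certificate, so that closure properties become polynomial
-- identities for the ring solver and numerical instances are checked by `refl`.
record _⊥_ (a b : ℤ) : Set where
  constructor bézout
  field
    x y      : ℤ
    identity : x * a + y * b ≡ 1ℤ

⊥-sym : ∀ {a b} → a ⊥ b → b ⊥ a
⊥-sym {a} {b} (bézout x y eq) = bézout y x (trans (ℤ.+-comm (y * b) (x * a)) eq)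

⊥-* : ∀ {a b c} → a ⊥ c → b ⊥ c → a * b ⊥ c
⊥-* {a} {b} {c} (bézout x y eq) (bézout x′ y′ eq′) =
  bézout (x * x′) (x * a * y′ + y * x′ * b + y * y′ * c)
    (trans (expand x y a x′ y′ b c) (cong₂ _*_ eq eq′))
  where
  expand : ∀ x y a x′ y′ b c →
    x * x′ * (a * b) + (x * a * y′ + y * x′ * b + y * y′ * c) * c
      ≡ (x * a + y * c) * (x′ * b + y′ * c)
  expand = solve-∀

⊥-*ʳ : ∀ {a b c} → a ⊥ b → a ⊥ c → a ⊥ b * c
⊥-*ʳ a⊥b a⊥c = ⊥-sym (⊥-* (⊥-sym a⊥b) (⊥-sym a⊥c))

⊥-*⁻ˡ : ∀ a b {c} → a * b ⊥ c → a ⊥ c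
⊥-*⁻ˡ a b {c} (bézout x y eq) = bézout (x * b) y (trans (regroup x y a b c) eq)
  where
  regroup : ∀ x y a b c → x * b * a + y * c ≡ x * (a * b) + y * c
  regroup = solve-∀

⊥-*ʳ⁻ˡ : ∀ {a} b c → a ⊥ b * c → a ⊥ b
⊥-*ʳ⁻ˡ b c a⊥bc = ⊥-sym (⊥-*⁻ˡ b c (⊥-sym a⊥bc))

⊥-*ʳ⁻ʳ : ∀ {a} b c → a ⊥ b * c → a ⊥ c
⊥-*ʳ⁻ʳ {a} b c a⊥bc = ⊥-*ʳ⁻ˡ c b (subst (a ⊥_) (ℤ.*-comm b c) a⊥bc)

⊥-neg : ∀ {a b} → a ⊥ b → - a ⊥ b
⊥-neg {a} {b} (bézout x y eq) = bézout (- x) y (trans (regroup x y a b) eq)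
  where
  regroup : ∀ x y a b → (- x) * (- a) + y * b ≡ x * a + y * b
  regroup = solve-∀

-- The main tool below: a coprimality claim is reduced to a congruence modulo `c` with a number
-- whose factors are already known to be prime to `c`.
⊥-shift : ∀ {a b c} k → a ⊥ c → b ≡ a + c * k → b ⊥ c
⊥-shift {a} {b} {c} k (bézout x y eq) refl =
  bézout x (y - x * k) (trans (regroup x y a c k) eq)
  where
  regroup : ∀ x y a c k → x * (a + c * k) + (y - x * k) * c ≡ x * a + y * c
  regroup = solve-∀

⊥⇒coprime : ∀ {a b} → a ⊥ b → Coprime ∣ a ∣ ∣ b ∣
⊥⇒coprime (bézout x y eq) {d} (d∣a , d∣b) = ℕ.∣1⇒≡1 (∣⇒∣ᵤ {+ d} {1ℤ} (subst (+ d ∣_) eq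
  (∣m∣n⇒∣m+n (∣n⇒∣m*n x (∣ᵤ⇒∣ {+ d} d∣a)) (∣n⇒∣m*n y (∣ᵤ⇒∣ {+ d} d∣b)))))

-- Powers of two

Odd : ℤ → Set
Odd a = a ⊥ + 2

even-not-odd : ∀ a → ¬ Odd (+ 2 * a)
even-not-odd a (bézout x y eq) with ℕ.m*n≡1⇒m≡1 2 ∣ x * a + y ∣
  (trans (sym (ℤ.abs-* (+ 2) (x * a + y))) (cong ∣_∣ (trans (regroup x y a) eq)))
  where
  regroup : ∀ x y a → + 2 * (x * a + y) ≡ x * (+ 2 * a) + y * + 2
  regroup = solve-∀
... | ()

record Dyadic (k : ℕ) (a : ℤ) : Set where
  constructor dyadic
  field
    oddPart : ℤ
    odd     : Odd oddPart
    eq      : a ≡ (+ 2) ^ k * oddPart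

odd⇒dyadic : ∀ {a} → Odd a → Dyadic 0 a
odd⇒dyadic {a} odd = dyadic a odd (sym (ℤ.*-identityˡ a))

-- The exponent of the second factor comes first, so that a numeral there lets the sum compute:
-- `3 + (4 + n)` reduces to `7 + n`.
dyadic-* : ∀ {j k a b} → Dyadic j a → Dyadic k b → Dyadic (k ℕ.+ j) (a * b)
dyadic-* {j} {k} (dyadic o odd refl) (dyadic o′ odd′ refl) = dyadic (o * o′) (⊥-* odd odd′)
  (trans (regroup ((+ 2) ^ j) o ((+ 2) ^ k) o′)
        (cong (_* (o * o′)) (sym (ℤ.^-distribˡ-+-* (+ 2) k j))))
  where
  regroup : ∀ p o p′ o′ → p * o * (p′ * o′) ≡ p′ * p * (o * o′)
  regroup = solve-∀

dyadic-unique : ∀ {j k a} → Dyadic j a → Dyadic k a → j ≡ k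
dyadic-unique {j} {k} (dyadic o odd eq) (dyadic o′ odd′ eq′) =
  go j k odd odd′ (trans (sym eq) eq′)
  where
  go : ∀ j k {o o′} → Odd o → Odd o′ → (+ 2) ^ j * o ≡ (+ 2) ^ k * o′ → j ≡ k
  go zero zero _ _ _ = refl
  go zero (suc k) {o} {o′} odd _ eq = ⊥-elim (even-not-odd ((+ 2) ^ k * o′)
    (subst Odd (trans (sym (ℤ.*-identityˡ o)) (trans eq (ℤ.*-assoc (+ 2) ((+ 2) ^ k) o′))) odd))
  go (suc j) zero odd odd′ eq = sym (go zero (suc j) odd′ odd (sym eq))
  go (suc j) (suc k) {o} {o′} odd odd′ eq = cong suc (go j k odd odd′
    (ℤ.*-cancelˡ-≡ (+ 2) _ _
      (trans (sym (ℤ.*-assoc (+ 2) ((+ 2) ^ j) o)) (trans eq (ℤ.*-assoc (+ 2) ((+ 2) ^ k) o′)))))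

dyadic⇒≢0 : ∀ {k a} → Dyadic k a → a ≢ 0ℤ
dyadic⇒≢0 {k} (dyadic o odd eq) a≡0 with ℤ.i*j≡0⇒i≡0∨j≡0 ((+ 2) ^ k) (trans (sym eq) a≡0)
... | inj₁ 2ᵏ≡0 with ℤ.i^n≡0⇒i≡0 (+ 2) k 2ᵏ≡0
...   | ()
dyadic⇒≢0 {k} (dyadic o odd eq) a≡0 | inj₂ refl = even-not-odd 0ℤ odd

-- Fractions with square denominator

∣a∣*∣a∣≡a*a : ∀ a → + (∣ a ∣ ℕ.* ∣ a ∣) ≡ a * a
∣a∣*∣a∣≡a*a (+ n)    = ℤ.pos-* n n
∣a∣*∣a∣≡a*a -[1+ n ] = refl

∣d∣²-pred : ∀ d → d ≢ 0ℤ → suc (ℕ.pred (∣ d ∣ ℕ.* ∣ d ∣)) ≡ ∣ d ∣ ℕ.* ∣ d ∣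
∣d∣²-pred d d≢0 = ℕ.suc-pred _ {{ℕ.m*n≢0 ∣ d ∣ ∣ d ∣}}
  where instance
  ∣d∣≢0 : ℕ.NonZero ∣ d ∣
  ∣d∣≢0 = ℕ.≢-nonZero (λ eq → d≢0 (ℤ.∣i∣≡0⇒i≡0 eq))

-- Built directly with `mkℚ`, which stores the denominator minus one; the lowest-terms denominator
-- is then d² without any normalisation.
squareFraction : ∀ n d → d ≢ 0ℤ → n ⊥ d → ℚ
squareFraction n d d≢0 n⊥d = mkℚ n (ℕ.pred (∣ d ∣ ℕ.* ∣ d ∣))
  (subst (Coprime ∣ n ∣) (sym (trans (∣d∣²-pred d d≢0) (sym (ℤ.abs-* d d))))
    (⊥⇒coprime (⊥-*ʳ n⊥d n⊥d)))

↧-squareFraction : ∀ n d d≢0 n⊥d → ↧ (squareFraction n d d≢0 n⊥d) ≡ d * d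
↧-squareFraction n d d≢0 n⊥d = trans (cong +_ (∣d∣²-pred d d≢0)) (∣a∣*∣a∣≡a*a d)

IsIntegerSquare : ℤ → Set
IsIntegerSquare a = ∃ λ r → a ≡ r * r

-- The witness is r/(de), written with the denominator (de)² so that it is visibly nonzero.
product+1-square : ∀ p q d e → ↧ p ≡ d * d → ↧ q ≡ e * e →
  IsIntegerSquare (↥ p * ↥ q + d * e * (d * e)) → IsRationalSquare (p ℚ.* q ℚ.+ 1ℚ)
product+1-square p@record{} q@record{} d e ↧p ↧q (r , eq) =
  fromℚᵘ s , ℚ.toℚᵘ-injective (begin-equality
  toℚᵘ (p ℚ.* q ℚ.+ 1ℚ)              ≃⟨ ℚ.toℚᵘ-homo-+ (p ℚ.* q) 1ℚ ⟩
  toℚᵘ (p ℚ.* q) ℚᵘ.+ 1ℚᵘ            ≃⟨ ℚᵘ.+-congˡ 1ℚᵘ (ℚ.toℚᵘ-homo-* p q) ⟩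
  toℚᵘ p ℚᵘ.* toℚᵘ q ℚᵘ.+ 1ℚᵘ        ≃⟨ *≡* (cross (↥ p) (↥ q) (↧ p) (↧ q) ↧p ↧q eq) ⟩
  s ℚᵘ.* s                           ≃⟨ ℚᵘ.*-cong (ℚ.toℚᵘ-fromℚᵘ s) (ℚ.toℚᵘ-fromℚᵘ s) ⟨
  toℚᵘ (fromℚᵘ s) ℚᵘ.* toℚᵘ (fromℚᵘ s) ≃⟨ ℚ.toℚᵘ-homo-* (fromℚᵘ s) (fromℚᵘ s) ⟨
  toℚᵘ (fromℚᵘ s ℚ.* fromℚᵘ s)       ∎)
  where
  open ℚᵘ.≤-Reasoning
  s : ℚᵘ
  s = mkℚᵘ (d * e * r) (ℕ.pred (ℚ.↧ₙ p ℕ.* ℚ.↧ₙ q))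
  cross : ∀ n n′ P Q → P ≡ d * d → Q ≡ e * e → n * n′ + d * e * (d * e) ≡ r * r →
    (n * n′ * 1ℤ + 1ℤ * (P * Q)) * (P * Q * (P * Q)) ≡ d * e * r * (d * e * r) * (P * Q * 1ℤ)
  cross n n′ P Q refl refl eq = adjust eq (d * d * (e * e) * (d * d * (e * e)))
    (solve (n ∷ n′ ∷ d ∷ e ∷ r ∷ []))

-- Points on the curve

-- The point u = 50h/N, y = 3w/N². Here b = (2500h² - N²)/3, and 3φ = N² + 2q, G = 2q - N² are the
-- factors of 4u⁴ - 1. The moduli 561 = 3·11·17 and 7 contain all odd primes that w could share
-- with φ or G.
record CurvePoint (ν : ℕ) : Set where
  field
    h N b w : ℤ

  q : ℤ
  q = h * h * + 2500

  φ : ℤ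
  φ = q - b

  G : ℤ
  G = q + b * + 3

  field
    N²       : N * N ≡ q - b * + 3
    w²       : w * w ≡ φ * φ - h * N * (h * N) * + 2244
    h⊥N      : h ⊥ N
    N⊥30     : N ⊥ + 30
    h⊥3      : h ⊥ + 3
    φ⊥561    : φ ⊥ + 561
    G⊥7      : G ⊥ + 7
    h-dyadic : Dyadic ν h

  φ² : φ * φ ≡ w * w + h * N * (h * N) * + 2244
  φ² = adjust w² (- + 1) (regroup (w * w) (φ * φ) (h * N * (h * N)))
    where
    regroup : ∀ x y t → y ≡ x + t * + 2244 + (x - (y - t * + 2244)) * - + 1
    regroup = solve-∀

  -- The quartic equals both (2u² + 1)² - (8 + X²)u² and (2u² - 1)² - X²u². The field `w²` is the
  -- first form times N⁴/9, with 2244 = 2500(8 + X²)/9; this is the second times N⁴, with 196 =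
  -- 2500X².
  G² : G * G ≡ w * w * + 9 + h * N * (h * N) * + 196
  G² = identity h N b w N² w²
    where
    identity : ∀ h N b w → let q = h * h * + 2500; φ = q - b; G = q + b * + 3 in
      N * N ≡ q - b * + 3 → w * w ≡ φ * φ - h * N * (h * N) * + 2244 →
      G * G ≡ w * w * + 9 + h * N * (h * N) * + 196
    identity h N b w N² w² = adjust N² (h * h * + 20000) (adjust w² (- + 9)
      (solve (h ∷ N ∷ b ∷ w ∷ [])))

  N⊥10 : N ⊥ + 10
  N⊥10 = ⊥-*ʳ⁻ˡ (+ 10) (+ 3) N⊥30

  N⊥2 : N ⊥ + 2
  N⊥2 = ⊥-*ʳ⁻ˡ (+ 2) (+ 5) N⊥10

  N⊥3 : N ⊥ + 3
  N⊥3 = ⊥-*ʳ⁻ʳ (+ 10) (+ 3) N⊥30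

  h²5000⊥N : h * h * + 5000 ⊥ N
  h²5000⊥N = ⊥-* (⊥-* h⊥N h⊥N) (⊥-*⁻ˡ (+ 5000) (+ 2)
    (⊥-* (⊥-* 10⊥N 10⊥N) (⊥-* 10⊥N 10⊥N)))
    where
    10⊥N : + 10 ⊥ N
    10⊥N = ⊥-sym N⊥10

  φ*3≡ : φ * + 3 ≡ N * N + h * h * + 5000
  φ*3≡ = identity h N b N²
    where
    identity : ∀ h N b → N * N ≡ h * h * + 2500 - b * + 3 →
      (h * h * + 2500 - b) * + 3 ≡ N * N + h * h * + 5000
    identity h N b N² = adjust N² (- + 1) (solve (h ∷ N ∷ b ∷ []))

  G≡ : G ≡ - (N * N) + h * h * + 5000
  G≡ = identity h N b N²
    where
    identity : ∀ h N b → N * N ≡ h * h * + 2500 - b * + 3 →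
      h * h * + 2500 + b * + 3 ≡ - (N * N) + h * h * + 5000
    identity h N b N² = adjust N² (+ 1) (solve (h ∷ N ∷ b ∷ []))

  -- Modulo a divisor of 5000h² one has 3φ ≡ N² and G ≡ -N²; modulo `N`, conversely, both 3φ and G
  -- reduce to 5000h².
  φ⊥ : ∀ {c} k → N ⊥ c → h * h * + 5000 ≡ c * k → φ ⊥ c
  φ⊥ k N⊥c ≡ck = ⊥-*⁻ˡ φ (+ 3) (⊥-shift k (⊥-* N⊥c N⊥c) (trans φ*3≡ (cong (_+_ (N * N)) ≡ck)))

  G⊥ : ∀ {c} k → N ⊥ c → h * h * + 5000 ≡ c * k → G ⊥ c
  G⊥ k N⊥c ≡ck = ⊥-shift k (⊥-neg (⊥-* N⊥c N⊥c)) (trans G≡ (cong (_+_ (- (N * N))) ≡ck))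

  h²5000≡10* : h * h * + 5000 ≡ + 10 * (h * h * + 500)
  h²5000≡10* = identity h
    where
    identity : ∀ h → h * h * + 5000 ≡ + 10 * (h * h * + 500)
    identity = solve-∀

  φ⊥10 : φ ⊥ + 10
  φ⊥10 = φ⊥ (h * h * + 500) N⊥10 h²5000≡10*

  G⊥10 : G ⊥ + 10
  G⊥10 = G⊥ (h * h * + 500) N⊥10 h²5000≡10*

  φ⊥h : φ ⊥ h
  φ⊥h = φ⊥ (h * + 5000) (⊥-sym h⊥N) (ℤ.*-assoc h h (+ 5000))

  G⊥h : G ⊥ h
  G⊥h = G⊥ (h * + 5000) (⊥-sym h⊥N) (ℤ.*-assoc h h (+ 5000))

  φ⊥N : φ ⊥ N
  φ⊥N = ⊥-*⁻ˡ φ (+ 3) (⊥-shift N h²5000⊥N (trans φ*3≡ (ℤ.+-comm (N * N) _)))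

  G⊥N : G ⊥ N
  G⊥N = ⊥-shift (- N) h²5000⊥N (trans G≡ (trans (ℤ.+-comm (- (N * N)) _)
    (cong (_+_ (h * h * + 5000)) (ℤ.neg-distribʳ-* N N))))

  φ⊥3 : φ ⊥ + 3
  φ⊥3 = ⊥-*ʳ⁻ˡ (+ 3) (+ 187) φ⊥561

  φ⊥187 : φ ⊥ + 187
  φ⊥187 = ⊥-*ʳ⁻ʳ (+ 3) (+ 187) φ⊥561

  φ⊥2 : φ ⊥ + 2
  φ⊥2 = ⊥-*ʳ⁻ˡ (+ 2) (+ 5) φ⊥10

  G⊥2 : G ⊥ + 2
  G⊥2 = ⊥-*ʳ⁻ˡ (+ 2) (+ 5) G⊥10

  G⊥3 : G ⊥ + 3
  G⊥3 = ⊥-shift b (⊥-* (⊥-* h⊥3 h⊥3) (bézout (+ 1) (- + 833) refl))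
    (cong (_+_ q) (ℤ.*-comm b (+ 3)))

  w⊥ : ∀ {c} k → φ ⊥ c → + 2244 ≡ c * k → w ⊥ c
  w⊥ {c} k φ⊥c eq = ⊥-*⁻ˡ w w (⊥-shift (- (t * k)) (⊥-* φ⊥c φ⊥c) (trans w²
    (cong (_+_ (φ * φ)) (trans (cong (λ z → - (t * z)) eq) (regroup t c k)))))
    where
    t : ℤ
    t = h * N * (h * N)
    regroup : ∀ t c k → - (t * (c * k)) ≡ c * - (t * k)
    regroup = solve-∀

  w⊥2 : w ⊥ + 2
  w⊥2 = w⊥ (+ 1122) φ⊥2 refl

  w⊥3 : w ⊥ + 3
  w⊥3 = w⊥ (+ 748) φ⊥3 refl

  w⊥187 : w ⊥ + 187
  w⊥187 = w⊥ (+ 12) φ⊥187 refl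

  -- The two forms of the curve give w² ≡ -2244h²N² modulo `φ` and 9w² ≡ -196h²N² modulo `G`, where
  -- 2244 = 4·561 and 196 = 14².
  w⊥φ : w ⊥ φ
  w⊥φ = ⊥-*⁻ˡ w w (⊥-shift φ (⊥-neg (⊥-* (⊥-* hN⊥φ hN⊥φ)
      (⊥-*⁻ˡ (+ 2244) (+ 1) (⊥-* (⊥-sym φ⊥561) (⊥-* 2⊥φ 2⊥φ)))))
    (trans w² (ℤ.+-comm (φ * φ) _)))
    where
    hN⊥φ : h * N ⊥ φ
    hN⊥φ = ⊥-* (⊥-sym φ⊥h) (⊥-sym φ⊥N)
    2⊥φ : + 2 ⊥ φ
    2⊥φ = ⊥-sym φ⊥2

  w⊥G : w ⊥ G
  w⊥G = ⊥-*⁻ˡ w w (⊥-*⁻ˡ (w * w) (+ 9) (⊥-shift G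
      (⊥-neg (⊥-* (⊥-* hN⊥G hN⊥G) (⊥-* 14⊥G 14⊥G)))
      (adjust G² (- + 1) (regroup (w * w) (G * G) (h * N * (h * N))))))
    where
    hN⊥G : h * N ⊥ G
    hN⊥G = ⊥-* (⊥-sym G⊥h) (⊥-sym G⊥N)
    14⊥G : + 14 ⊥ G
    14⊥G = ⊥-* {+ 2} {+ 7} (⊥-sym G⊥2) (⊥-sym G⊥7)
    regroup : ∀ x y t → x * + 9 ≡ - (t * + 196) + y + (y - (x * + 9 + t * + 196)) * - + 1
    regroup = solve-∀

-- Doubling

-- Up to sign, 50h₂/N₂ is 2uy/(1 - 4u⁴) with a common factor 3 removed; in b₂ the squares φ²
-- and G² have been eliminated, so that division by 3 is exact.
module _ {ν : ℕ} (P : CurvePoint ν) where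
  open CurvePoint P

  double : CurvePoint (suc ν)
  double = record
    { h = h₂
    ; N = N₂
    ; b = b₂
    ; w = w₂
    ; N² = N₂²≡ (h * N) w φ G φ² G²
    ; w² = w₂²≡ (h * N) w φ G φ² G²
    ; h⊥N = ⊥-*ʳ h₂⊥φ h₂⊥G
    ; N⊥30 = ⊥-*ʳ {b = + 10} {c = + 3} (⊥-* φ⊥10 G⊥10) (⊥-* φ⊥3 G⊥3)
    ; h⊥3 = ⊥-* {b = + 2} (⊥-* (⊥-* h⊥3 N⊥3) w⊥3) (bézout (+ 2) (- + 1) refl)
    ; φ⊥561 = ⊥-*ʳ {b = + 3} {c = + 187} φ₂⊥3 φ₂⊥187
    ; G⊥7 = ⊥-*⁻ˡ G₂ (+ 9) (⊥-shift (t * t * - + 560000)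
        (⊥-neg (⊥-* (⊥-* G⊥7 G⊥7) (⊥-* G⊥7 G⊥7))) (G₂*9≡ (h * N) w φ G φ² G²))
    ; h-dyadic = h₂-dyadic h-dyadic
    }
    where
    t x h₂ N₂ b₂ w₂ φ₂ G₂ : ℤ
    t = h * N * (h * N)
    x = w * w
    h₂ = h * N * w * + 2
    N₂ = φ * G
    b₂ = t * x * + 3268 - x * (x + t * + 2244) * + 3 - t * t * + 146608
    -- Put α = 3w²φ² and β = 748h²N²G². Then `φ₂` equals α + β and 4αβ = 2244(h₂N₂)², so α - β
    -- solves the equation for `w₂`.
    w₂ = x * (φ * φ) * + 3 - t * (G * G) * + 748
    φ₂ = h₂ * h₂ * + 2500 - b₂
    G₂ = h₂ * h₂ * + 2500 + b₂ * + 3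

    N₂²≡ : ∀ m w φ G → let t = m * m; x = w * w; h₂ = m * w * + 2
                           b₂ = t * x * + 3268 - x * (x + t * + 2244) * + 3 - t * t * + 146608 in
      φ * φ ≡ x + t * + 2244 → G * G ≡ x * + 9 + t * + 196 →
      φ * G * (φ * G) ≡ h₂ * h₂ * + 2500 - b₂ * + 3
    N₂²≡ m w φ G φ² G² = adjust φ² (G * G) (adjust G² (w * w + m * m * + 2244)
      (solve (m ∷ w ∷ φ ∷ G ∷ [])))

    w₂²≡ : ∀ m w φ G → let t = m * m; x = w * w; h₂ = m * w * + 2
                           b₂ = t * x * + 3268 - x * (x + t * + 2244) * + 3 - t * t * + 146608
                           w₂ = x * (φ * φ) * + 3 - t * (G * G) * + 748
                           φ₂ = h₂ * h₂ * + 2500 - b₂ in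
      φ * φ ≡ x + t * + 2244 → G * G ≡ x * + 9 + t * + 196 →
      w₂ * w₂ ≡ φ₂ * φ₂ - h₂ * (φ * G) * (h₂ * (φ * G)) * + 2244
    w₂²≡ m w φ G φ² G² = adjust φ² (w * w * s * + 3) (adjust G² (m * m * s * + 748)
      (identity m w φ G))
      where
      -- `φ₂` is α + β with φ² and G² eliminated. The two versions are compared through a difference
      -- of squares, and `s` is their sum.
      s : ℤ
      s = w * w * (φ * φ) * + 3 + m * m * (G * G) * + 748
        + (w * w * (w * w + m * m * + 2244) * + 3 + m * m * (w * w * + 9 + m * m * + 196) * + 748)
      identity : ∀ m w φ G → let t = m * m; x = w * w; h₂ = m * w * + 2
                                 b₂ = t * x * + 3268 - x * (x + t * + 2244) * + 3 - t * t * + 146608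
                                 w₂ = x * (φ * φ) * + 3 - t * (G * G) * + 748
                                 φ₂ = h₂ * h₂ * + 2500 - b₂
                                 s = x * (φ * φ) * + 3 + t * (G * G) * + 748
                                   + (x * (x + t * + 2244) * + 3
                                       + t * (x * + 9 + t * + 196) * + 748) in
        w₂ * w₂ ≡ φ₂ * φ₂ - h₂ * (φ * G) * (h₂ * (φ * G)) * + 2244
          + (φ * φ - (x + t * + 2244)) * (x * s * + 3)
          + (G * G - (x * + 9 + t * + 196)) * (t * s * + 748)
      identity = solve-∀

    -- Modulo 3 only the second summand survives, and modulo 187 only the first because 748 = 4·187;
    -- this keeps `φ₂` prime to 561.
    φ₂≡ : ∀ m w φ G → let t = m * m; x = w * w; h₂ = m * w * + 2
                          b₂ = t * x * + 3268 - x * (x + t * + 2244) * + 3 - t * t * + 146608 in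
      φ * φ ≡ x + t * + 2244 → G * G ≡ x * + 9 + t * + 196 →
      h₂ * h₂ * + 2500 - b₂ ≡ x * (φ * φ) * + 3 + t * (G * G) * + 748
    φ₂≡ m w φ G φ² G² = adjust φ² (w * w * - + 3) (adjust G² (m * m * - + 748)
      (solve (m ∷ w ∷ φ ∷ G ∷ [])))

    -- Modulo 7 the number X vanishes and the curve becomes y = ±(2u² - 1). Doubling then sends 2u²
    -- - 1 to -((2u² - 1)/(2u² + 1))², which is the term -G⁴ once denominators are cleared.
    G₂*9≡ : ∀ m w φ G → let t = m * m; x = w * w; h₂ = m * w * + 2
                            b₂ = t * x * + 3268 - x * (x + t * + 2244) * + 3 - t * t * + 146608 in
      φ * φ ≡ x + t * + 2244 → G * G ≡ x * + 9 + t * + 196 →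
      (h₂ * h₂ * + 2500 + b₂ * + 3) * + 9 ≡ - (G * G * (G * G)) + + 7 * (t * t * - + 560000)
    G₂*9≡ m w φ G φ² G² = adjust G² (G * G + (w * w * + 9 + m * m * + 196))
      (solve (m ∷ w ∷ φ ∷ G ∷ []))

    h₂⊥ : ∀ {c} → h ⊥ c → N ⊥ c → w ⊥ c → + 2 ⊥ c → h₂ ⊥ c
    h₂⊥ h⊥c N⊥c w⊥c 2⊥c = ⊥-* (⊥-* (⊥-* h⊥c N⊥c) w⊥c) 2⊥c

    h₂⊥φ : h₂ ⊥ φ
    h₂⊥φ = h₂⊥ (⊥-sym φ⊥h) (⊥-sym φ⊥N) w⊥φ (⊥-sym φ⊥2)

    h₂⊥G : h₂ ⊥ G
    h₂⊥G = h₂⊥ (⊥-sym G⊥h) (⊥-sym G⊥N) w⊥G (⊥-sym G⊥2)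

    φ₂⊥3 : φ₂ ⊥ + 3
    φ₂⊥3 = ⊥-shift (x * (φ * φ))
      (⊥-* (⊥-* (⊥-* hN⊥3 hN⊥3) (⊥-* G⊥3 G⊥3)) (bézout (+ 1) (- + 249) refl))
      (trans (φ₂≡ (h * N) w φ G φ² G²) (regroup (x * (φ * φ)) (t * (G * G) * + 748)))
      where
      hN⊥3 : h * N ⊥ + 3
      hN⊥3 = ⊥-* h⊥3 N⊥3
      regroup : ∀ y z → y * + 3 + z ≡ z + + 3 * y
      regroup = solve-∀

    φ₂⊥187 : φ₂ ⊥ + 187
    φ₂⊥187 = ⊥-shift (t * (G * G) * + 4)
      (⊥-* (⊥-* (⊥-* w⊥187 w⊥187) (⊥-* φ⊥187 φ⊥187)) (bézout (- + 62) (+ 1) refl))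
      (trans (φ₂≡ (h * N) w φ G φ² G²) (regroup (x * (φ * φ) * + 3) (t * (G * G))))
      where
      regroup : ∀ y z → y + z * + 748 ≡ y + + 187 * (z * + 4)
      regroup = solve-∀

    h₂-dyadic : Dyadic ν h → Dyadic (suc ν) h₂
    h₂-dyadic (dyadic o odd eq) = dyadic (o * N * w) (⊥-* (⊥-* odd N⊥2) w⊥2)
      (trans (cong (λ y → y * N * w * + 2) eq) (regroup ((+ 2) ^ ν) o N w))
      where
      regroup : ∀ p o N w → p * o * N * w * + 2 ≡ + 2 * p * (o * N * w)
      regroup = solve-∀

-- The double of the point u = 16/25.
initial : CurvePoint 4
initial = record
  { h = + 80
  ; N = + 42827
  ; b = - + 606050643
  ; w = + 600504493
  ; N² = refl
  ; w² = refl
  ; h⊥N = bézout (- + 1606) (+ 3) refl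
  -- The point u = 16/25 itself does not qualify: it is 50·8/625, and 625 is not prime to 30.
  ; N⊥30 = bézout (- + 7) (+ 9993) refl
  ; h⊥3 = bézout (- + 1) (+ 27) refl
  ; φ⊥561 = bézout (+ 262) (- + 290512065) refl
  ; G⊥7 = bézout (- + 2) (- + 514900551) refl
  ; h-dyadic = dyadic (+ 5) (bézout (+ 1) (- + 2) refl) refl
  }

-- The squares

-- The witnesses are square roots with denominators cleared: 2u² - 1 for ab + 1, X for ac + 1 (as ac
-- = -T²), 2u for ad + 1, 1/u for bc + 1 and (2u² - 1)/(2u²) for cd + 1. `w` is a parameter so that
-- `- w` can take its place.
module SquareIdentities (h N b w : ℤ)
  (N² : N * N ≡ h * h * + 2500 - b * + 3)
  (w² : w * w ≡ (h * h * + 2500 - b) * (h * h * + 2500 - b) - h * N * (h * N) * + 2244)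
  where

  ab : IsIntegerSquare (h * h * + 4800 * (b * + 25) + N * (N * + 2) * (N * (N * + 2)))
  ab = (h * h * + 2500 + b * + 3) * + 2 ,
    adjust N² (N * N * + 4 + h * h * + 10000 - b * + 12)
    (solve (h ∷ N ∷ b ∷ w ∷ []))

  ac : IsIntegerSquare (h * h * + 4800 * - (N * N * + 3) + N * (h * + 125) * (N * (h * + 125)))
  ac = N * h * + 35 ,
    solve (h ∷ N ∷ b ∷ w ∷ [])

  ad : let q = h * h * + 2500; K = q + b in
    IsIntegerSquare (h * h * + 4800 * K + N * (h * + 40) * (N * (h * + 40)))
  ad = h * h * + 4000 ,
    adjust N² (h * h * + 1600)
    (solve (h ∷ N ∷ b ∷ w ∷ []))

  -- With r = 2u² - 1, the root is (y + 2Xu³)/r here, (y + 2Xu(u² - 1))/(Tr) in `be`, (2uy -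
  -- X)/(2ur) in `ce` and (2uy + X(4u² - 1))/(2Tur) in `de`.
  ae : let q = h * h * + 2500; φ = q - b; G = q + b * + 3 in
    IsIntegerSquare (h * h * + 4800 * ((φ * G * + 7 + h * N * w * + 5000) * + 7)
      + N * (G * + 20) * (N * (G * + 20)))
  ae = N * w * + 60 + h * h * h * + 1400000 ,
    adjust N² (h * h * N * N * + 8078400 + h * h * h * h * + 196000000 - h * h * b * + 235200)
    (adjust w² (N * N * - + 3600) (solve (h ∷ N ∷ b ∷ w ∷ [])))

  bc : IsIntegerSquare (b * + 25 * - (N * N * + 3)
      + N * + 2 * (h * + 125) * (N * + 2 * (h * + 125)))
  bc = N * N * + 5 ,
    adjust N² (N * N * - + 25)
    (solve (h ∷ N ∷ b ∷ w ∷ []))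

  -- This condition is the source of the curve: bd + 1 is its quartic divided by (Tu)², so the root
  -- is y/(Tu).
  bd : let q = h * h * + 2500; K = q + b in
    IsIntegerSquare (b * + 25 * K + N * + 2 * (h * + 40) * (N * + 2 * (h * + 40)))
  bd = w * + 5 ,
    adjust N² (h * h * + 62500)
    (adjust w² (- + 25) (solve (h ∷ N ∷ b ∷ w ∷ [])))

  be : let q = h * h * + 2500; φ = q - b; G = q + b * + 3 in
    IsIntegerSquare (b * + 25 * ((φ * G * + 7 + h * N * w * + 5000) * + 7)
      + N * + 2 * (G * + 20) * (N * + 2 * (G * + 20)))
  be = N * w * + 125 + h * b * + 3500 ,
    adjust N² (h * h * N * N * + 35062500 - b * b * + 1225 - h * h * b * + 3062500)
    (adjust w² (N * N * - + 15625) (solve (h ∷ N ∷ b ∷ w ∷ [])))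

  cd : let q = h * h * + 2500; K = q + b in
    IsIntegerSquare (- (N * N * + 3) * K + h * + 125 * (h * + 40) * (h * + 125 * (h * + 40)))
  cd = h * h * + 2500 + b * + 3 ,
    adjust N² (h * h * - + 7500 - b * + 3)
    (solve (h ∷ N ∷ b ∷ w ∷ []))

  ce : let q = h * h * + 2500; φ = q - b; G = q + b * + 3 in
    IsIntegerSquare (- (N * N * + 3) * ((φ * G * + 7 + h * N * w * + 5000) * + 7)
      + h * + 125 * (G * + 20) * (h * + 125 * (G * + 20)))
  ce = h * w * + 7500 - N * N * N * + 7 ,
    adjust N² (N * N * b * + 147 - N * N * N * N * + 49 - h * h * N * N * + 122500
      + h * h * h * h * + 125000000000)
    (adjust w² (h * h * - + 56250000) (solve (h ∷ N ∷ b ∷ w ∷ [])))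

  de : let q = h * h * + 2500; φ = q - b; G = q + b * + 3; K = q + b in
    IsIntegerSquare (K * ((φ * G * + 7 + h * N * w * + 5000) * + 7)
      + h * + 40 * (G * + 20) * (h * + 40 * (G * + 20)))
  de = h * w * + 2500 + N * (h * h * + 2500 + b) * + 7 ,
    adjust N² (h * h * h * h * + 13718750000 - b * b * + 49 - h * h * b * + 245000)
    (adjust w² (h * h * - + 6250000) (solve (h ∷ N ∷ b ∷ w ∷ [])))

-- Here `m` is `h * N`. Eliminating φ² and G² leaves a binary quadratic form in w² and m² of
-- discriminant zero, and the witness is its square root.
ef-square : ∀ m w φ G → φ * φ ≡ w * w + m * m * + 2244 → G * G ≡ w * w * + 9 + m * m * + 196 →
  IsIntegerSquare ((φ * G * + 7 + m * w * + 5000) * + 7 * ((φ * G * + 7 + m * - w * + 5000) * + 7)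
    + G * + 20 * (G * + 20) * (G * + 20 * (G * + 20)))
ef-square m w φ G φ² G² = w * w * + 3603 - m * m * + 84868 , adjust φ² (G * G * + 2401)
  (adjust G² ((w * w + m * m * + 2244) * + 2401
      + (G * G + (w * w * + 9 + m * m * + 196)) * + 160000)
    (solve (m ∷ w ∷ φ ∷ G ∷ [])))

-- Pairs of indices

pattern #0 = zero
pattern #1 = suc zero
pattern #2 = suc (suc zero)
pattern #3 = suc (suc (suc zero))
pattern #4 = suc (suc (suc (suc zero)))
pattern #5 = suc (suc (suc (suc (suc zero))))

pairwise : (P : Fin 6 → Fin 6 → Set) → (∀ i j → P i j → P j i) →
  P #0 #1 → P #0 #2 → P #0 #3 → P #0 #4 → P #0 #5 →
  P #1 #2 → P #1 #3 → P #1 #4 → P #1 #5 →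
  P #2 #3 → P #2 #4 → P #2 #5 →
  P #3 #4 → P #3 #5 →
  P #4 #5 →
  ∀ i j → i ≢ j → P i j
pairwise P P-sym p01 p02 p03 p04 p05 p12 p13 p14 p15 p23 p24 p25 p34 p35 p45 = go
  where
  increasing : ∀ i j → i Fin.< j → P i j
  increasing #0 #1 _ = p01
  increasing #0 #2 _ = p02
  increasing #0 #3 _ = p03
  increasing #0 #4 _ = p04
  increasing #0 #5 _ = p05
  increasing #1 #2 _ = p12
  increasing #1 #3 _ = p13
  increasing #1 #4 _ = p14
  increasing #1 #5 _ = p15
  increasing #2 #3 _ = p23
  increasing #2 #4 _ = p24
  increasing #2 #5 _ = p25
  increasing #3 #4 _ = p34
  increasing #3 #5 _ = p35
  increasing #4 #5 _ = p45
  increasing (suc _) #1 (s≤s ())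
  increasing (suc (suc _)) #2 (s≤s (s≤s ()))
  increasing (suc (suc (suc _))) #3 (s≤s (s≤s (s≤s ())))
  increasing (suc (suc (suc (suc _)))) #4 (s≤s (s≤s (s≤s (s≤s ()))))
  increasing #5 #5 (s≤s (s≤s (s≤s (s≤s (s≤s ())))))

  go : ∀ i j → i ≢ j → P i j
  go i j i≢j with Fin.<-cmp i j
  ... | tri< i<j _ _ = increasing i j i<j
  ... | tri≈ _ i≡j _ = ⊥-elim (i≢j i≡j)
  ... | tri> _ _ j<i = P-sym j i (increasing j i j<i)

-- The sextuple

-- The 2-adic valuations of the square roots of the denominators.
valuation : ℕ → Fin 6 → ℕ
valuation n #0 = 0
valuation n #1 = 1
valuation n #2 = 4 ℕ.+ n
valuation n #3 = 7 ℕ.+ n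
valuation n #4 = 2
valuation n #5 = 2

valuation≤ : ∀ n i → valuation n i ℕ.≤ 7 ℕ.+ n
valuation≤ n #0 = z≤n
valuation≤ n #1 = s≤s z≤n
valuation≤ n #2 = ℕ.m≤n+m (4 ℕ.+ n) 3
valuation≤ n #3 = ℕ.≤-refl
valuation≤ n #4 = s≤s (s≤s z≤n)
valuation≤ n #5 = s≤s (s≤s z≤n)

-- The offset 4 puts the valuations `4 + n` and `7 + n` of the roots for c and d above the values 0,
-- 1, 2, 2 of the others, so that most inequalities between them hold by computation.
module Sextuple {n : ℕ} (P : CurvePoint (4 ℕ.+ n)) where
  open CurvePoint P

  K : ℤ
  K = q + b

  numer root : Fin 6 → ℤ

  numer #0 = h * h * + 4800
  numer #1 = b * + 25
  numer #2 = - (N * N * + 3)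
  numer #3 = K
  numer #4 = (φ * G * + 7 + h * N * w * + 5000) * + 7
  numer #5 = (φ * G * + 7 + h * N * - w * + 5000) * + 7

  root #0 = N
  root #1 = N * + 2
  root #2 = h * + 125
  root #3 = h * + 40
  root #4 = G * + 20
  root #5 = G * + 20

  -- 729000000 = 30⁶
  ⊥N : ∀ c k → c * k ≡ + 729000000 → c ⊥ N
  ⊥N c k eq = ⊥-*⁻ˡ c k (subst (_⊥ N) (sym eq) (⊥-* 27000⊥N 27000⊥N))
    where
    30⊥N : + 30 ⊥ N
    30⊥N = ⊥-sym N⊥30
    27000⊥N : + 27000 ⊥ N
    27000⊥N = ⊥-* {+ 30} {+ 900} 30⊥N (⊥-* {+ 30} {+ 30} 30⊥N 30⊥N)

  b*3≡ : b * + 3 ≡ - (N * N) + h * h * + 2500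
  b*3≡ = adjust N² (+ 1) (regroup (N * N) q (b * + 3))
    where
    regroup : ∀ s q b → b ≡ - s + q + (s - (q - b)) * + 1
    regroup = solve-∀

  -- As 3b = 2500h² - N² and 3K = 10000h² - N², coprimality is shown for the triples and the factor
  -- 3 is then dropped.
  b⊥N : b ⊥ N
  b⊥N = ⊥-*⁻ˡ b (+ 3) (⊥-shift (- N) (⊥-* (⊥-* h⊥N h⊥N) (⊥N (+ 2500) (+ 291600) refl))
    (trans b*3≡ (regroup N (h * h * + 2500))))
    where
    regroup : ∀ N y → - (N * N) + y ≡ y + N * - N
    regroup = solve-∀

  b⊥2 : b ⊥ + 2
  b⊥2 = ⊥-*⁻ˡ b (+ 3) (⊥-shift (h * h * + 1250) (⊥-neg (⊥-* N⊥2 N⊥2))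
    (trans b*3≡ (regroup (N * N) (h * h))))
    where
    regroup : ∀ s y → - s + y * + 2500 ≡ - s + + 2 * (y * + 1250)
    regroup = solve-∀

  K*3≡ : K * + 3 ≡ - (N * N) + h * h * + 10000
  K*3≡ = trans (regroup (h * h) b) (trans (cong (_+ h * h * + 7500) b*3≡) (collect (N * N) (h * h)))
    where
    regroup : ∀ y b → (y * + 2500 + b) * + 3 ≡ b * + 3 + y * + 7500
    regroup = solve-∀
    collect : ∀ s y → - s + y * + 2500 + y * + 7500 ≡ - s + y * + 10000
    collect = solve-∀

  K⊥h : K ⊥ h
  K⊥h = ⊥-*⁻ˡ K (+ 3) (⊥-shift (h * + 10000) (⊥-neg (⊥-* (⊥-sym h⊥N) (⊥-sym h⊥N)))
    (trans K*3≡ (cong (_+_ (- (N * N))) (ℤ.*-assoc h h (+ 10000)))))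

  K⊥40 : K ⊥ + 40
  K⊥40 = ⊥-*⁻ˡ K (+ 3) (⊥-shift (h * h * + 250) (⊥-neg (⊥-* N⊥40 N⊥40))
    (trans K*3≡ (regroup (N * N) (h * h))))
    where
    N⊥40 : N ⊥ + 40
    N⊥40 = ⊥-sym (⊥N (+ 40) (+ 18225000) refl)
    regroup : ∀ s y → - s + y * + 10000 ≡ - s + + 40 * (y * + 250)
    regroup = solve-∀

  -- Modulo `G` only 5000hNv survives in the bracket, and modulo 20 only 7φG. Taking `v` to be `w`
  -- or `- w` covers e and f.
  ef⊥ : ∀ {v} → v ⊥ G → (φ * G * + 7 + h * N * v * + 5000) * + 7 ⊥ G * + 20
  ef⊥ {v} v⊥G = ⊥-* (⊥-*ʳ ⊥G ⊥20) (⊥-*ʳ (⊥-sym G⊥7) (bézout (+ 3) (- + 1) refl))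
    where
    10⊥G : + 10 ⊥ G
    10⊥G = ⊥-sym G⊥10
    5000⊥G : + 5000 ⊥ G
    5000⊥G = ⊥-*⁻ˡ (+ 5000) (+ 2) (⊥-* {+ 100} {+ 100}
      (⊥-* {+ 10} {+ 10} 10⊥G 10⊥G) (⊥-* {+ 10} {+ 10} 10⊥G 10⊥G))
    ⊥10⇒⊥20 : ∀ {a} → a ⊥ + 10 → a ⊥ + 20
    ⊥10⇒⊥20 a⊥10 = ⊥-*ʳ⁻ˡ (+ 20) (+ 5) (⊥-*ʳ {b = + 10} {c = + 10} a⊥10 a⊥10)
    ⊥G : φ * G * + 7 + h * N * v * + 5000 ⊥ G
    ⊥G = ⊥-shift (φ * + 7) (⊥-* (⊥-* (⊥-* (⊥-sym G⊥h) (⊥-sym G⊥N)) v⊥G) 5000⊥G)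
      (regroup φ G (h * N * v * + 5000))
      where
      regroup : ∀ φ G y → φ * G * + 7 + y ≡ y + G * (φ * + 7)
      regroup = solve-∀
    ⊥20 : φ * G * + 7 + h * N * v * + 5000 ⊥ + 20
    ⊥20 = ⊥-shift (h * N * v * + 250)
      (⊥-* (⊥-* (⊥10⇒⊥20 φ⊥10) (⊥10⇒⊥20 G⊥10)) (bézout (+ 3) (- + 1) refl))
      (regroup (φ * G * + 7) (h * N * v))
      where
      regroup : ∀ y z → y + z * + 5000 ≡ y + + 20 * (z * + 250)
      regroup = solve-∀

  numer⊥root : ∀ i → numer i ⊥ root i
  numer⊥root #0 = ⊥-* (⊥-* h⊥N h⊥N) (⊥N (+ 4800) (+ 151875) refl)
  numer⊥root #1 = ⊥-*ʳ
    (⊥-* b⊥N (⊥N (+ 25) (+ 29160000) refl))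
    (⊥-* b⊥2 (bézout (+ 1) (- + 12) refl))
  numer⊥root #2 = ⊥-neg (⊥-*ʳ
    (⊥-* (⊥-* (⊥-sym h⊥N) (⊥-sym h⊥N)) (⊥-sym h⊥3))
    (⊥-* (⊥-* N⊥125 N⊥125) (bézout (+ 42) (- + 1) refl)))
    where
    N⊥125 : N ⊥ + 125
    N⊥125 = ⊥-sym (⊥N (+ 125) (+ 5832000) refl)
  numer⊥root #3 = ⊥-*ʳ K⊥h K⊥40
  numer⊥root #4 = ef⊥ w⊥G
  numer⊥root #5 = ef⊥ (⊥-neg w⊥G)

  odd⇒≢0 : ∀ {a} → Odd a → a ≢ 0ℤ
  odd⇒≢0 odd = dyadic⇒≢0 (odd⇒dyadic odd)

  -- All numerators but the first are odd; the first has a definite valuation, with 4800 = 2⁶·75.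
  numer≢0 : ∀ i → numer i ≢ 0ℤ
  numer≢0 #0 = dyadic⇒≢0 (dyadic-* (dyadic-* h-dyadic h-dyadic)
    (dyadic {k = 6} (+ 75) (bézout (+ 1) (- + 37) refl) refl))
  numer≢0 #1 = odd⇒≢0 (⊥-*ʳ⁻ʳ N (+ 2) (numer⊥root #1))
  numer≢0 #2 = odd⇒≢0 (⊥-neg (⊥-* (⊥-* N⊥2 N⊥2) (bézout (+ 1) (- + 1) refl)))
  numer≢0 #3 = odd⇒≢0 (⊥-*ʳ⁻ˡ (+ 2) (+ 20) K⊥40)
  numer≢0 #4 = odd⇒≢0 (⊥-*ʳ⁻ˡ (+ 2) (+ 10) (⊥-*ʳ⁻ʳ G (+ 20) (numer⊥root #4)))
  numer≢0 #5 = odd⇒≢0 (⊥-*ʳ⁻ˡ (+ 2) (+ 10) (⊥-*ʳ⁻ʳ G (+ 20) (numer⊥root #5)))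

  root-dyadic : ∀ i → Dyadic (valuation n i) (root i)
  root-dyadic #0 = odd⇒dyadic N⊥2
  root-dyadic #1 = dyadic-* (odd⇒dyadic N⊥2) (dyadic {k = 1} (+ 1) (bézout (+ 1) 0ℤ refl) refl)
  root-dyadic #2 = dyadic-* h-dyadic (dyadic {k = 0} (+ 125) (bézout (+ 1) (- + 62) refl) refl)
  root-dyadic #3 = dyadic-* h-dyadic (dyadic {k = 3} (+ 5) (bézout (+ 1) (- + 2) refl) refl)
  root-dyadic #4 = dyadic-* (odd⇒dyadic G⊥2) (dyadic {k = 2} (+ 5) (bézout (+ 1) (- + 2) refl) refl)
  root-dyadic #5 = dyadic-* (odd⇒dyadic G⊥2) (dyadic {k = 2} (+ 5) (bézout (+ 1) (- + 2) refl) refl)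

  root≢0 : ∀ i → root i ≢ 0ℤ
  root≢0 i = dyadic⇒≢0 (root-dyadic i)

  element : Fin 6 → ℚ
  element i = squareFraction (numer i) (root i) (root≢0 i) (numer⊥root i)

  ↧-element : ∀ i → ↧ (element i) ≡ root i * root i
  ↧-element i = ↧-squareFraction (numer i) (root i) (root≢0 i) (numer⊥root i)

  element-dyadic : ∀ i → Dyadic (valuation n i ℕ.+ valuation n i) (↧ (element i))
  element-dyadic i = subst (Dyadic _) (sym (↧-element i)) (dyadic-* (root-dyadic i) (root-dyadic i))

  squareDenominators : HasSquareDenominators element
  squareDenominators i = ∣ root i ∣ , ∣d∣²-pred (root i) (root≢0 i)

-- Equal rationals share their lowest-terms denominator, whose 2-adic valuation is twice
-- `valuation`. Allowing two points serves both distinctness within a sextuple and the comparison of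
-- sextuples.
equal⇒valuation≡ : ∀ {m n} (P : CurvePoint (4 ℕ.+ m)) (Q : CurvePoint (4 ℕ.+ n)) i j →
  Sextuple.element P i ≡ Sextuple.element Q j → valuation m i ≡ valuation n j
equal⇒valuation≡ {m} {n} P Q i j eq = double-injective (dyadic-unique
  (subst (λ x → Dyadic (valuation m i ℕ.+ valuation m i) (↧ x)) eq
    (Sextuple.element-dyadic P i))
  (Sextuple.element-dyadic Q j))
  where
  double-injective : ∀ {j k} → j ℕ.+ j ≡ k ℕ.+ k → j ≡ k
  double-injective {j} {k} eq =
    trans (ℕ.n≡⌊n+n/2⌋ j) (trans (cong ⌊_/2⌋ eq) (sym (ℕ.n≡⌊n+n/2⌋ k)))

module _ {n : ℕ} (P : CurvePoint (4 ℕ.+ n)) where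
  open CurvePoint P
  open Sextuple P

  distinct-elements : ∀ i j → element i ≡ element j → i ≡ j
  distinct-elements i j eq = decidable-stable (i Fin.≟ j) λ i≢j →
    pairwise (λ i j → element i ≢ element j) (λ _ _ a≢b b≡a → a≢b (sym b≡a))
    (by-valuation #0 #1 λ ()) (by-valuation #0 #2 λ ()) (by-valuation #0 #3 λ ())
    (by-valuation #0 #4 λ ()) (by-valuation #0 #5 λ ())
    (by-valuation #1 #2 λ ()) (by-valuation #1 #3 λ ()) (by-valuation #1 #4 λ ())
    (by-valuation #1 #5 λ ())
    (by-valuation #2 #3 (ℕ.<⇒≢ (ℕ.m<n+m (4 ℕ.+ n) {3} (s≤s z≤n)))) (by-valuation #2 #4 λ ())
    (by-valuation #2 #5 λ ())
    (by-valuation #3 #4 λ ()) (by-valuation #3 #5 λ ())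
    e≢f i j i≢j eq
    where
    by-valuation : ∀ i j → valuation n i ≢ valuation n j → element i ≢ element j
    by-valuation i j v≢ eq = v≢ (equal⇒valuation≡ P P i j eq)

    -- The valuations of e and f agree, but their numerators differ by 70000hNw, with 70000 =
    -- 2⁴·4375.
    e≢f : element #4 ≢ element #5
    e≢f eq = dyadic⇒≢0
      (dyadic-* (dyadic-* (dyadic-* h-dyadic (odd⇒dyadic N⊥2)) (odd⇒dyadic w⊥2))
        (dyadic {k = 4} (+ 4375) (bézout (+ 1) (- + 2187) refl) refl))
      (collapse (φ * G * + 7) (h * N) w (cong ↥_ eq))
      where
      collapse : ∀ y m w → (y + m * w * + 5000) * + 7 ≡ (y + m * - w * + 5000) * + 7 →
        m * w * + 70000 ≡ 0ℤ
      collapse y m w eq = adjust eq (+ 1) (solve (y ∷ m ∷ w ∷ []))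

  isSextuple : IsRationalDiophantineSextuple element
  isSextuple = record
    { distinct = distinct-elements
    ; nonzero  = λ i eq → numer≢0 i (cong ↥_ eq)
    ; squares  = pairwise (λ i j → IsRationalSquare (element i ℚ.* element j ℚ.+ 1ℚ))
        (λ i j → subst (λ x → IsRationalSquare (x ℚ.+ 1ℚ)) (ℚ.*-comm (element i) (element j)))
        (square #0 #1 +w.ab) (square #0 #2 +w.ac) (square #0 #3 +w.ad)
        (square #0 #4 +w.ae) (square #0 #5 -w.ae)
        (square #1 #2 +w.bc) (square #1 #3 +w.bd) (square #1 #4 +w.be) (square #1 #5 -w.be)
        (square #2 #3 +w.cd) (square #2 #4 +w.ce) (square #2 #5 -w.ce)
        (square #3 #4 +w.de) (square #3 #5 -w.de)
        (square #4 #5 (ef-square (h * N) w φ G φ² G²))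
    }
    where
    module +w = SquareIdentities h N b w N² w²

    [-w]² : ∀ w → (- w) * (- w) ≡ w * w
    [-w]² = solve-∀

    -- Replacing y by -y fixes a, b, c, d and exchanges e with f.
    module -w = SquareIdentities h N b (- w) N² (trans ([-w]² w) w²)

    square : ∀ i j → IsIntegerSquare (numer i * numer j + root i * root j * (root i * root j)) →
      IsRationalSquare (element i ℚ.* element j ℚ.+ 1ℚ)
    square i j = product+1-square (element i) (element j) (root i) (root j)
      (↧-element i) (↧-element j)

-- The orbit under doubling and the infinitude of sextuples

point : ∀ n → CurvePoint (4 ℕ.+ n)
point zero    = initial
point (suc n) = double (point n)

sextuple : ℕ → Fin 6 → ℚ
sextuple n = Sextuple.element (point n)

theorem1 : Σ (ℕ → Fin 6 → ℚ) λ f →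
    (∀ n → IsRationalDiophantineSextuple (f n) × HasSquareDenominators (f n))
    × (∀ n m → SameSet (f n) (f m) → n ≡ m)
theorem1 = sextuple
  , (λ n → isSextuple (point n) , Sextuple.squareDenominators (point n))
  , λ n m (n⊆m , m⊆n) → ℕ.≤-antisym (d∈⇒≤ n m (n⊆m #3)) (d∈⇒≤ m n (m⊆n #3))
  where
  -- The element d of the sextuple `n` has valuation `7 + n`, while no element of the sextuple `m`
  -- exceeds `7 + m`. The two inclusions give the two inequalities.
  d∈⇒≤ : ∀ n m → (∃ λ i → sextuple n #3 ≡ sextuple m i) → n ℕ.≤ m
  d∈⇒≤ n m (i , eq) = ℕ.+-cancelˡ-≤ 7 n m (subst (ℕ._≤ 7 ℕ.+ m)
    (sym (equal⇒valuation≡ (point n) (point m) #3 i eq)) (valuation≤ m i))
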